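{- \textsc{Semi-Weighted Component Order Connectivity} parameterized by $\mathrm{fes}(G) + \Delta(G)$ is fpt-reducible to \textsc{Semi-Weighted Vertex Integrity} parameterized by $\mathrm{fes}(G) + \Delta(G)$.
   Context: All graphs are finite, simple and undirected; $\Delta(G)$ is the maximum degree of $G$, and $\mathrm{fes}(G)$ (feedback edge set number) is the minimum number of edges whose removal makes $G$ acyclic. For a vertex weight function $w: V(G) \to \mathbb{Z}^+$ and $X \subseteq V(G)$, $w(X) = \sum_{x \in X} w(x)$. \textsc{Semi-Weighted Component Order Connectivity}: given a vertex-weighted graph $G=(V,E,w)$ with $w: V \to \mathbb{Z}^+$ and integers $\ell, p \in \mathbb{Z}^+$, decide whether there is $S \subseteq V$ with $|S| \le p$ such that $w(D) \le \ell$ for every connected component $D$ of $G - S$. \textsc{Semi-Weighted Vertex Integrity}: given a vertex-weighted graph $G=(V,E,w)$ with $w: V \to \mathbb{Z}^+$ and an integer $\ell \in \mathbb{Z}^+$, decide whether there is $S \subseteq V$ such that $|S| + w(D) \le \ell$ for every connected component $D$ of $G - S$. An fpt-reduction is a parameterized reduction: it maps instances to equivalent instances in time $f(\kappa) \cdot n^{O(1)}$ and the new parameter is bounded by a computable function of the old parameter $\kappa$.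
   Formalization: In Semi-Weighted Vertex Integrity the condition |S| ≤ ℓ is added, so that S = V (no components left) does not make every instance a yes-instance; the weights, ℓ and p are taken to be encoded in unary. -}

module Defs where

open import Data.Bool.Base using (Bool; true; false)
open import Data.Fin.Base as Fin using (Fin; toℕ)
open import Data.Fin.Properties using () renaming (_≟_ to _≟ᶠ_)
open import Data.Fin.Subset using (Subset; _∈_; _∉_; ∣_∣)
open import Data.Fin.Subset.Properties using (_∈?_)
open import Data.List.Base
  using (List; []; _∷_; [_]; _++_; map; concatMap; filter; length; sum; allFin; replicate; reverse)
open import Data.List.Extrema.Nat using (max)
import Data.List.Membership.Propositional as ListMembership
import Data.List.Membership.DecPropositional as DecListMembership
open import Data.List.Relation.Binary.Sublist.Propositional using (_⊆_)
open import Data.List.Relation.Unary.All using (All)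
import Data.List.Relation.Unary.All.Properties as All
open import Data.List.Relation.Unary.Linked using (Linked)
open import Data.List.Relation.Unary.Unique.Propositional using (Unique)
import Data.List.Relation.Unary.Unique.Propositional.Properties as Unique
open import Data.Maybe.Base using (Maybe; just; nothing)
open import Data.Nat.Base using (ℕ; zero; suc; _+_; _*_; _^_; _≤_; _<_)
open import Data.Product.Base using (∃; ∃-syntax; _×_; _,_; proj₁; proj₂)
open import Data.Product.Properties using (≡-dec)
open import Data.Sum.Base using (_⊎_)
open import Data.Vec.Base as Vec using (Vec)
open import Function.Bundles using (_⇔_; _↔_)
open import Relation.Binary.Construct.Closure.ReflexiveTransitive using (Star)
open import Relation.Binary.Definitions using (DecidableEquality)
open import Relation.Binary.PropositionalEquality.Core using (_≡_)
open import Relation.Nullary using (¬_; Dec)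
open import Relation.Nullary.Decidable using (_⊎-dec_)

------------------------------------------------------------------------
-- Graphs

-- An undirected edge {u , v} is listed exactly once, as the pair
-- (u , v) with u < v.
record Graph : Set where
  field
    order   : ℕ
    edges   : List (Fin order × Fin order)
    ordered : All (λ e → proj₁ e Fin.< proj₂ e) edges
    unique  : Unique edges

  Vertex : Set
  Vertex = Fin order

  Edge : Set
  Edge = Vertex × Vertex

  _≟ᵉ_ : DecidableEquality Edge
  _≟ᵉ_ = ≡-dec _≟ᶠ_ _≟ᶠ_

  open ListMembership using () renaming (_∈_ to _∈ˡ_)

  Adjacent : Vertex → Vertex → Set
  Adjacent u v = (u , v) ∈ˡ edges ⊎ (v , u) ∈ˡ edges

  Incident : Vertex → Edge → Set
  Incident v e = v ≡ proj₁ e ⊎ v ≡ proj₂ e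

  incident? : ∀ v e → Dec (Incident v e)
  incident? v e = (v ≟ᶠ proj₁ e) ⊎-dec (v ≟ᶠ proj₂ e)

  degree : Vertex → ℕ
  degree v = length (filter (incident? v) edges)

  -- The maximum degree Δ(G), with value 0 on the empty graph.
  Δ : ℕ
  Δ = max 0 (map degree (allFin order))

  -- v, vs list the distinct vertices of a cycle in cyclic order.
  IsCycle : Vertex → List Vertex → Set
  IsCycle v vs = 2 ≤ length vs × Unique (v ∷ vs) × Linked Adjacent (v ∷ vs ++ [ v ])

  Acyclic : Set
  Acyclic = ∀ v vs → ¬ IsCycle v vs

  -- Adjacency in G − S.
  data AdjacentOutside (S : Subset order) (u v : Vertex) : Set where
    edge : u ∉ S → v ∉ S → Adjacent u v → AdjacentOutside S u v

  -- D is the vertex set of a connected component of G − S.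
  IsComponent : Subset order → Subset order → Set
  IsComponent S D =
    ∃[ v ] v ∉ S × (∀ u → u ∈ D ⇔ Star (AdjacentOutside S) v u)

open Graph public using (order; Δ; Vertex; Edge; Acyclic; IsComponent)

deleteEdges : (G : Graph) → List (Edge G) → Graph
deleteEdges G F = record
  { order   = Graph.order G
  ; edges   = filter (_∉? F) (Graph.edges G)
  ; ordered = All.filter⁺ (_∉? F) (Graph.ordered G)
  ; unique  = Unique.filter⁺ (_∉? F) (Graph.unique G)
  }
  where open DecListMembership (Graph._≟ᵉ_ G) using (_∉?_)

-- Sublists of the duplicate-free list of edges are the sets of edges.
FeedbackEdgeSet : (G : Graph) → List (Edge G) → Set
FeedbackEdgeSet G F = F ⊆ Graph.edges G × Acyclic (deleteEdges G F)

-- fes(G) = k.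
IsFes : Graph → ℕ → Set
IsFes G k =
  (∃[ F ] FeedbackEdgeSet G F × length F ≡ k) ×
  (∀ F → FeedbackEdgeSet G F → k ≤ length F)

-- fes(G) + Δ(G) = κ.
IsFes+Δ : Graph → ℕ → Set
IsFes+Δ G κ = ∃[ k ] IsFes G k × κ ≡ k + Δ G

record WeightedGraph : Set where
  field
    graph      : Graph
    weight     : Vertex graph → ℕ
    weight-pos : ∀ v → 0 < weight v

  totalWeight : Subset (order graph) → ℕ
  totalWeight X = sum (map weight (filter (_∈? X) (allFin (order graph))))

open WeightedGraph public using (graph; weight; totalWeight)

------------------------------------------------------------------------
-- Encoding as words
--
-- Numbers, in particular the weights, ℓ and p, are written in unary, so
-- the length of an encoding is polynomially related to the sum of the
-- order of the graph, its total weight, and the numbers ℓ and p.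

Word : Set
Word = List Bool

encodeℕ : ℕ → Word
encodeℕ n = replicate n true ++ [ false ]

numbers : WeightedGraph → List ℕ
numbers W =
  order (graph W) ∷
  map (weight W) (allFin (order (graph W))) ++
  concatMap (λ e → toℕ (proj₁ e) ∷ toℕ (proj₂ e) ∷ []) (Graph.edges (graph W))

------------------------------------------------------------------------
-- Multi-tape Turing machines

Cell : Set
Cell = Maybe Bool

pattern blank = nothing

data Move : Set where
  left stay right : Move

-- A two-way infinite tape that is blank outside the recorded part. The
-- cells to the left of the head are listed from the head outwards.
record Tape : Set where
  constructor tape
  field
    before : List Cell
    head   : Cell
    after  : List Cell

write : Cell → Tape → Tape
write c (tape ls _ rs) = tape ls c rs

move : Move → Tape → Tape
move left  (tape []       c rs)       = tape [] blank (c ∷ rs)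
move left  (tape (l ∷ ls) c rs)       = tape ls l (c ∷ rs)
move stay  t                          = t
move right (tape ls       c [])       = tape (c ∷ ls) blank []
move right (tape ls       c (r ∷ rs)) = tape (c ∷ ls) r rs

blankTape : Tape
blankTape = tape [] blank []

loadTape : Word → Tape
loadTape []      = blankTape
loadTape (a ∷ w) = tape [] (just a) (map just w)

-- The tape contains w and is blank elsewhere.
Contains : Tape → Word → Set
Contains (tape ls c rs) w =
  ∃[ i ] ∃[ j ]
    reverse ls ++ c ∷ rs ≡ replicate i blank ++ map just w ++ replicate j blank

-- One input tape, one output tape and some work tapes; all of them may
-- be read and written. The machine halts when δ returns nothing.
record Machine : Set₁ where
  field
    workTapes : ℕ

  tapes : ℕ
  tapes = 2 + workTapes

  field
    State  : Set
    finite : ∃[ q ] State ↔ Fin q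
    start  : State
    δ      : State → Vec Cell tapes → Maybe (State × Vec (Cell × Move) tapes)

  Config : Set
  Config = State × Vec Tape tapes

  act : Cell × Move → Tape → Tape
  act (c , m) t = move m (write c t)

  step : Config → Maybe Config
  step (q , ts) with δ q (Vec.map Tape.head ts)
  ... | nothing        = nothing
  ... | just (q′ , as) = just (q′ , Vec.zipWith act as ts)

  initial : Word → Config
  initial w = start , loadTape w Vec.∷ Vec.replicate (suc workTapes) blankTape

  -- c reaches the halting configuration d after exactly t steps.
  data HaltsIn : ℕ → Config → Config → Set where
    halt : ∀ {c} → step c ≡ nothing → HaltsIn 0 c c
    next : ∀ {t c c′ d} → step c ≡ just c′ → HaltsIn t c′ d → HaltsIn (suc t) c d

  outputTape : Config → Tape
  outputTape (_ , _ Vec.∷ t Vec.∷ _) = t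

  -- On input w the machine halts after exactly t steps with output v.
  Outputs : Word → ℕ → Word → Set
  Outputs w t v = ∃[ d ] HaltsIn t (initial w) d × Contains (outputTape d) v

open Machine public using (Outputs)

Computable : (ℕ → ℕ) → Set₁
Computable h =
  ∃[ M ] ∀ n → ∃[ t ] Outputs M (encodeℕ n) t (encodeℕ (h n))

------------------------------------------------------------------------
-- Parameterized problems and fpt-reductions

record ParameterizedProblem : Set₁ where
  field
    Instance  : Set
    Yes       : Instance → Set
    encode    : Instance → Word
    -- The parameter of the instance is κ.
    Parameter : Instance → ℕ → Set

record FptReduction (A B : ParameterizedProblem) : Set₁ where
  private
    module A = ParameterizedProblem A
    module B = ParameterizedProblem B
  field
    reduce       : A.Instance → B.Instance
    correct      : ∀ x → A.Yes x ⇔ B.Yes (reduce x)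

    machine      : Machine
    time         : A.Instance → ℕ
    computes     : ∀ x → Outputs machine (A.encode x) (time x) (B.encode (reduce x))
    f            : ℕ → ℕ
    f-computable : Computable f
    exponent     : ℕ
    time-bound   : ∀ x κ → A.Parameter x κ →
                   time x ≤ f κ * length (A.encode x) ^ exponent

    g            : ℕ → ℕ
    g-computable : Computable g
    param-bound  : ∀ x κ κ′ → A.Parameter x κ → B.Parameter (reduce x) κ′ → κ′ ≤ g κ

------------------------------------------------------------------------
-- The two problems

record COCInstance : Set where
  field
    input : WeightedGraph
    ℓ p   : ℕ
    ℓ-pos : 0 < ℓ
    p-pos : 0 < p

SemiWeightedCOC : ParameterizedProblem
SemiWeightedCOC = record
  { Instance  = COCInstance
  ; Yes       = λ I → let open COCInstance I in
      ∃[ S ] ∣ S ∣ ≤ p ×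
             (∀ D → IsComponent (graph input) S D → totalWeight input D ≤ ℓ)
  ; encode    = λ I → let open COCInstance I in
      concatMap encodeℕ (p ∷ ℓ ∷ numbers input)
  ; Parameter = λ I → IsFes+Δ (graph (COCInstance.input I))
  }

record VIInstance : Set where
  field
    input : WeightedGraph
    ℓ     : ℕ
    ℓ-pos : 0 < ℓ

-- The condition on S is |S| + max w(D) ≤ ℓ, the maximum being 0 if G − S
-- has no component. Without the explicit bound on |S|, which matters only
-- in that case, S = V would make every instance a yes-instance.
SemiWeightedVI : ParameterizedProblem
SemiWeightedVI = record
  { Instance  = VIInstance
  ; Yes       = λ I → let open VIInstance I in
      ∃[ S ] ∣ S ∣ ≤ ℓ ×
             (∀ D → IsComponent (graph input) S D → ∣ S ∣ + totalWeight input D ≤ ℓ)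
  ; encode    = λ I → let open VIInstance I in
      concatMap encodeℕ (ℓ ∷ numbers input)
  ; Parameter = λ I → IsFes+Δ (graph (VIInstance.input I))
  }

{-# OPTIONS --safe #-}

-- Put c = p + 1. Multiply all weights by c, set the new bound to ℓ′ = p + ℓ c and add
-- k = ℓ′ + 1 isolated vertices of weight ℓ c. A solution S has at most ℓ′ vertices, so it
-- misses an isolated vertex, and |S| + ℓ c ≤ p + ℓ c gives |S| ≤ p. Every other component D
-- then satisfies c w(D) ≤ p + ℓ c < c (ℓ + 1), that is w(D) ≤ ℓ; the slack p − |S| is
-- absorbed by the scaling. Isolated vertices change neither fes nor Δ.

module Submission where

open import Defs
open import Data.Bool.Base using (Bool; true; false)
open import Data.Fin.Base as Fin using (Fin; zero; suc; toℕ; _↑ˡ_; _↑ʳ_; splitAt)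
open import Data.Fin.Properties
  using (toℕ-↑ˡ; ↑ˡ-injective; ↑ʳ-injective; splitAt-↑ˡ; splitAt-↑ʳ; join-splitAt)
open import Data.Fin.Subset using (Subset; _∈_; _∉_; ∣_∣; ⊥; ⁅_⁆; inside; outside)
open import Data.Fin.Subset.Properties
  using (_∈?_; drop-there; Empty-unique; ∉⊥; ⊆-antisym; x∈⁅x⁆; x∈⁅y⁆⇒x≡y; ∣⊥∣≡0; ∣⁅x⁆∣≡1)
open import Data.List.Base
  using (List; []; _∷_; [_]; _++_; _ʳ++_; map; concatMap; filter; length; replicate; reverse;
         allFin; tabulate)
open import Data.List.Extrema.Nat using (xs≤max; max≤v⁺)
import Data.List.Membership.DecPropositional as DecListMembership
open import Data.List.Membership.Propositional using () renaming (_∈_ to _∈ˡ_)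
open import Data.List.Membership.Propositional.Properties
  using (∈-map⁺; ∈-map⁻; ∈-filter⁺; ∈-filter⁻; ∈-allFin)
open import Data.List.Properties
  using (++-assoc; ++-identityʳ; length-++; length-map; length-replicate; length-tabulate;
         map-++; map-tabulate; tabulate-cong; concatMap-++; filter-none; reverse-map; ʳ++-defn)
import Data.List.Relation.Binary.Sublist.Propositional.Properties as Sublist
open import Data.List.Relation.Unary.All as All using (All)
import Data.List.Relation.Unary.All.Properties as All
import Data.List.Relation.Unary.AllPairs as AllPairs
import Data.List.Relation.Unary.AllPairs.Properties as AllPairs
open import Data.List.Relation.Unary.Linked as Linked using (Linked; _∷_)
import Data.List.Relation.Unary.Linked.Properties as Linked
import Data.List.Relation.Unary.Unique.Propositional.Properties as Unique
open import Data.Maybe.Base using (Maybe; just; nothing)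
open import Data.Nat.Base
open import Data.Nat.ListAction using (sum)
open import Data.Nat.Properties
open import Data.Nat.Tactic.RingSolver using (solve-∀)
open import Data.Product.Base using (∃-syntax; _×_; _,_; proj₁; proj₂)
open import Data.Product.Properties using (,-injectiveˡ; ,-injectiveʳ)
open import Data.Sum.Base as Sum using (_⊎_; inj₁; inj₂)
open import Data.Vec.Base as Vec using (Vec; []; _∷_; here; there)
open import Data.Vec.Properties using (lookup-++ˡ; lookup-++ʳ; lookup⇒[]=; []=⇒lookup)
open import Function.Base using (_∘_; id)
open import Function.Bundles using (_⇔_; mk⇔; Equivalence)
open import Function.Construct.Identity using (↔-id)
open import Relation.Binary.Construct.Closure.ReflexiveTransitive as Star using (Star; ε; _◅_)
open import Relation.Binary.PropositionalEquality
  using (_≡_; _≢_; refl; sym; trans; cong; cong₂; subst; subst₂; module ≡-Reasoning)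
open import Relation.Nullary using (¬_; yes; no; contradiction)
open import Relation.Unary using (Decidable)

-- The padding adds (ℓ + 1)(p + 1) vertices of weight ℓ (p + 1). The unary encoding keeps this
-- polynomial in the input length, so the running time is polynomial outright and the parameter
-- enters only through `fes` and `Δ`. The larger obstacle is not the equivalence but an explicit
-- machine with a step count, and several choices serve it. The new vertices are numbered after the
-- old ones: the edge part of the word is copied verbatim, the scaled weights precede the new ones,
-- and a vertex set of the padded graph is a concatenation `A ++ B` of bit vectors. Every number
-- written is a sum or a product of unary blocks: a sum arises by leaving out a separator, a product
-- by sweeping a stored counter once per input symbol.

length-filter-map :
  ∀ {A B : Set} {P : A → Set} {Q : B → Set} (P? : Decidable P) (Q? : Decidable Q) (f : A → B) →
  (∀ {x} → Q (f x) → P x) → ∀ xs → length (filter Q? (map f xs)) ≤ length (filter P? xs)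
length-filter-map P? Q? f q⇒p []       = z≤n
length-filter-map P? Q? f q⇒p (x ∷ xs) with P? x | Q? (f x)
... | yes _ | yes _ = s≤s (length-filter-map P? Q? f q⇒p xs)
... | yes _ | no  _ = m≤n⇒m≤1+n (length-filter-map P? Q? f q⇒p xs)
... | no ¬p | yes q = contradiction (q⇒p q) ¬p
... | no _  | no  _ = length-filter-map P? Q? f q⇒p xs

-- Adding isolated vertices

module _ (G : Graph) (k : ℕ) where
  open Graph G hiding (order; Δ; Vertex; Edge; Acyclic; IsComponent)

  private
    n = order G

  old : Fin n → Fin (n + k)
  old v = v ↑ˡ k

  new : Fin k → Fin (n + k)
  new b = n ↑ʳ b

  oldEdge : Fin n × Fin n → Fin (n + k) × Fin (n + k)
  oldEdge (u , v) = old u , old v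

  old-injective : ∀ {u v} → old u ≡ old v → u ≡ v
  old-injective = ↑ˡ-injective k _ _

  oldEdge-injective : ∀ {e f} → oldEdge e ≡ oldEdge f → e ≡ f
  oldEdge-injective eq =
    cong₂ _,_ (old-injective (,-injectiveˡ eq)) (old-injective (,-injectiveʳ eq))

  withIsolated : Graph
  withIsolated = record
    { order   = n + k
    ; edges   = map oldEdge edges
    ; ordered = All.map⁺ (All.map (subst₂ _<_ (sym (toℕ-↑ˡ _ k)) (sym (toℕ-↑ˡ _ k))) ordered)
    ; unique  = Unique.map⁺ oldEdge-injective unique
    }

  data OldOrNew : Fin (n + k) → Set where
    isOld : ∀ v → OldOrNew (old v)
    isNew : ∀ b → OldOrNew (new b)

  oldOrNew : ∀ x → OldOrNew x
  oldOrNew x with splitAt n x in eq | join-splitAt n k x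
  ... | inj₁ v | refl = isOld v
  ... | inj₂ b | refl = isNew b

  old≢new : ∀ {u b} → old u ≢ new b
  old≢new {u} {b} eq
    with trans (sym (splitAt-↑ˡ n u k)) (trans (cong (splitAt n) eq) (splitAt-↑ʳ n k b))
  ... | ()

  module _ where
    private module G′ = Graph withIsolated

    incident-old : ∀ v e → G′.Incident (old v) (oldEdge e) → Incident v e
    incident-old v e = Sum.map old-injective old-injective

    incident-new : ∀ b e → ¬ G′.Incident (new b) (oldEdge e)
    incident-new b e (inj₁ eq) = old≢new (sym eq)
    incident-new b e (inj₂ eq) = old≢new (sym eq)

    Δ-withIsolated : Δ withIsolated ≤ Δ G
    Δ-withIsolated =
      max≤v⁺ {xs = map G′.degree (allFin (n + k))} z≤n (All.map⁺ (All.universal bound _))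
      where
      bound : ∀ x → G′.degree x ≤ Δ G
      bound x with oldOrNew x
      ... | isOld v = ≤-trans
        (length-filter-map (incident? v) (G′.incident? (old v)) oldEdge (incident-old v _) edges)
        (All.lookup (xs≤max 0 (map degree (allFin n))) (∈-map⁺ degree (∈-allFin v)))
      ... | isNew b = subst (_≤ Δ G)
        (sym (cong length (filter-none (G′.incident? (new b))
          (All.map⁺ (All.universal (incident-new b) edges))))) z≤n

  edge-ends : ∀ es {x y} → (x , y) ∈ˡ map oldEdge es →
              ∃[ u ] ∃[ v ] x ≡ old u × y ≡ old v × (u , v) ∈ˡ es
  edge-ends es xy∈ with ∈-map⁻ oldEdge xy∈
  ... | (u , v) , uv∈ , refl = u , v , refl , refl , uv∈

  -- Stated for an arbitrary list `es` because it serves both the edges of `G` and the edges that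
  -- remain after a deletion.
  adjacent-ends : ∀ es {x y} → (x , y) ∈ˡ map oldEdge es ⊎ (y , x) ∈ˡ map oldEdge es →
                  ∃[ u ] ∃[ v ] x ≡ old u × y ≡ old v × ((u , v) ∈ˡ es ⊎ (v , u) ∈ˡ es)
  adjacent-ends es (inj₁ xy∈) with edge-ends es xy∈
  ... | u , v , x≡ , y≡ , uv∈ = u , v , x≡ , y≡ , inj₁ uv∈
  adjacent-ends es (inj₂ yx∈) with edge-ends es yx∈
  ... | v , u , y≡ , x≡ , vu∈ = u , v , x≡ , y≡ , inj₂ vu∈

-- Feedback edge sets after adding isolated vertices

module _ (G : Graph) (k : ℕ) (F : List (Edge G)) where
  private
    G′ = withIsolated G k
    F′ = map (oldEdge G k) F
    module H  = Graph (deleteEdges G F)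
    module H′ = Graph (deleteEdges G′ F′)
    old′ = old G k

    open DecListMembership (Graph._≟ᵉ_ G) using () renaming (_∉?_ to _∉F?_)
    open DecListMembership (Graph._≟ᵉ_ G′) using () renaming (_∉?_ to _∉F′?_)

  edges-deleted : ∀ {e} → e ∈ˡ H′.edges → e ∈ˡ map (oldEdge G k) H.edges
  edges-deleted e∈ with ∈-filter⁻ (_∉F′? F′) {xs = Graph.edges G′} e∈
  ... | e∈G′ , e∉F′ with ∈-map⁻ (oldEdge G k) e∈G′
  ... | _ , e∈G , refl =
    ∈-map⁺ (oldEdge G k) (∈-filter⁺ (_∉F? F) e∈G (e∉F′ ∘ ∈-map⁺ (oldEdge G k)))

  adjacent-deleted : ∀ {x y} → H′.Adjacent x y →
                     ∃[ u ] ∃[ v ] x ≡ old′ u × y ≡ old′ v × H.Adjacent u v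
  adjacent-deleted = adjacent-ends G k H.edges ∘ Sum.map edges-deleted edges-deleted

  adjacent-old : ∀ {u v} → H′.Adjacent (old′ u) (old′ v) → H.Adjacent u v
  adjacent-old a with adjacent-deleted a
  ... | _ , _ , u≡ , v≡ , a′ with old-injective G k u≡ | old-injective G k v≡
  ... | refl | refl = a′

  -- Each element of `xs` is the tail of an edge of the walk and hence old; `y` gives the last
  -- element its successor. Applied to a closed walk, this pulls a whole cycle back to the old
  -- graph.
  linked-sources : ∀ xs {y} → Linked H′.Adjacent (xs ++ [ y ]) → ∃[ us ] xs ≡ map old′ us
  linked-sources []           _       = [] , refl
  linked-sources (x ∷ [])     (a ∷ _) with adjacent-deleted a
  ... | u , _ , refl , _ = u ∷ [] , refl
  linked-sources (x ∷ y ∷ xs) (a ∷ l) with adjacent-deleted a | linked-sources (y ∷ xs) l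
  ... | u , _ , refl , _ | us , eq = u ∷ us , cong (_ ∷_) eq

  acyclic-withIsolated : Acyclic (deleteEdges G F) → Acyclic (deleteEdges G′ F′)
  acyclic-withIsolated acyclic x xs (2≤len , unique , linked) with linked-sources (x ∷ xs) linked
  ... | u ∷ us , refl = acyclic u us
    ( subst (2 ≤_) (length-map old′ us) 2≤len
    , AllPairs.map (λ ne eq → ne (cong old′ eq)) (AllPairs.map⁻ {xs = u ∷ us} unique)
    , Linked.map adjacent-old (Linked.map⁻ {xs = u ∷ us ++ [ u ]} linked′)
    )
    where
    linked′ : Linked H′.Adjacent (map old′ (u ∷ us ++ [ u ]))
    linked′ = subst (Linked H′.Adjacent) (cong (_ ∷_) (sym (map-++ old′ us [ u ]))) linked

  feedback-withIsolated : FeedbackEdgeSet G F → FeedbackEdgeSet G′ F′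
  feedback-withIsolated (F⊆E , acyclic) =
    Sublist.map⁺ (oldEdge G k) F⊆E , acyclic-withIsolated acyclic

-- A minimum feedback edge set `F` of `G` maps to a feedback edge set of the same size, which bounds
-- the new minimum from above.
fes+Δ-withIsolated : ∀ G k κ κ′ → IsFes+Δ G κ → IsFes+Δ (withIsolated G k) κ′ → κ′ ≤ κ
fes+Δ-withIsolated G k _ _ (f , ((F , fes , refl) , _) , refl) (f′ , (_ , min) , refl) =
  +-mono-≤ (subst (f′ ≤_) (length-map (oldEdge G k) F) (min _ (feedback-withIsolated G k F fes)))
           (Δ-withIsolated G k)

-- Components and their weights

∈-++ˡ⁺ : ∀ {m n} {A : Subset m} (B : Subset n) {u} → u ∈ A → u ↑ˡ n ∈ A Vec.++ B
∈-++ˡ⁺ {A = A} B {u} u∈A = lookup⇒[]= _ _ (trans (lookup-++ˡ A B u) ([]=⇒lookup u∈A))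

∈-++ˡ⁻ : ∀ {m n} (A : Subset m) (B : Subset n) {u} → u ↑ˡ n ∈ A Vec.++ B → u ∈ A
∈-++ˡ⁻ A B {u} u∈ = lookup⇒[]= _ _ (trans (sym (lookup-++ˡ A B u)) ([]=⇒lookup u∈))

∈-++ʳ⁺ : ∀ {m n} (A : Subset m) {B : Subset n} {b} → b ∈ B → m ↑ʳ b ∈ A Vec.++ B
∈-++ʳ⁺ A {B} {b} b∈B = lookup⇒[]= _ _ (trans (lookup-++ʳ A B b) ([]=⇒lookup b∈B))

∈-++ʳ⁻ : ∀ {m n} (A : Subset m) (B : Subset n) {b} → m ↑ʳ b ∈ A Vec.++ B → b ∈ B
∈-++ʳ⁻ A B {b} b∈ = lookup⇒[]= _ _ (trans (sym (lookup-++ʳ A B b)) ([]=⇒lookup b∈))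

∣++∣ : ∀ {m n} (A : Subset m) (B : Subset n) → ∣ A Vec.++ B ∣ ≡ ∣ A ∣ + ∣ B ∣
∣++∣ []            B = refl
∣++∣ (inside  ∷ A) B = cong suc (∣++∣ A B)
∣++∣ (outside ∷ A) B = ∣++∣ A B

∃-∉ : ∀ {n} (B : Subset n) → ∣ B ∣ < n → ∃[ b ] b ∉ B
∃-∉ (outside ∷ B) _ = zero , λ ()
∃-∉ (inside  ∷ B) (s≤s ∣B∣<n) with ∃-∉ B ∣B∣<n
... | b , b∉B = suc b , b∉B ∘ drop-there

module _ (G : Graph) (k : ℕ) (A : Subset (order G)) (B : Subset k) where
  private
    G′ = withIsolated G k
    S′ = A Vec.++ B
    module G  = Graph G
    module G′ = Graph G′
    old′ = old G k
    new′ = new G k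
    _⟶*_  = Star (G.AdjacentOutside A)
    _⟶′*_ = Star (G′.AdjacentOutside S′)

  adjacentOutside-old : ∀ {u v} → G.AdjacentOutside A u v → G′.AdjacentOutside S′ (old′ u) (old′ v)
  adjacentOutside-old (Graph.edge u∉A v∉A a) = Graph.edge
    (u∉A ∘ ∈-++ˡ⁻ A B) (v∉A ∘ ∈-++ˡ⁻ A B)
    (Sum.map (∈-map⁺ (oldEdge G k)) (∈-map⁺ (oldEdge G k)) a)

  path-old : ∀ {u v} → u ⟶* v → old′ u ⟶′* old′ v
  path-old = Star.gmap old′ adjacentOutside-old

  -- The endpoint is an arbitrary `x`, found to be old only at the end, so that induction on the
  -- path goes through intermediate vertices not yet known to be old.
  path-from-old : ∀ {u x} → old′ u ⟶′* x → ∃[ v ] x ≡ old′ v × u ⟶* v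
  path-from-old ε = _ , refl , ε
  path-from-old (Graph.edge u∉S v∉S a ◅ r) with adjacent-ends G k G.edges a
  ... | _ , v , u≡ , refl , a′ with old-injective G k u≡ | path-from-old r
  ... | refl | w , eq , r′ =
    w , eq , Graph.edge (u∉S ∘ ∈-++ˡ⁺ B) (v∉S ∘ ∈-++ˡ⁺ B) a′ ◅ r′

  path-from-new : ∀ {b x} → new′ b ⟶′* x → x ≡ new′ b
  path-from-new ε = refl
  path-from-new (Graph.edge _ _ a ◅ r) with adjacent-ends G k G.edges a
  ... | _ , _ , b≡ , _ = contradiction (sym b≡) (old≢new G k)

  path-old⁻ : ∀ {u v} → old′ u ⟶′* old′ v → u ⟶* v
  path-old⁻ {u} r with path-from-old r
  ... | v , eq , r′ = subst (u ⟶*_) (sym (old-injective G k eq)) r′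

  old-new-unreachable : ∀ {u b} → ¬ old′ u ⟶′* new′ b
  old-new-unreachable r with path-from-old r
  ... | v , eq , _ = old≢new G k (sym eq)

  component-old : ∀ {D} → IsComponent G A D → IsComponent G′ S′ (D Vec.++ ⊥)
  component-old {D} (v , v∉A , reach) = old′ v , v∉A ∘ ∈-++ˡ⁻ A B , reach′
    where
    reach′ : ∀ x → x ∈ D Vec.++ ⊥ ⇔ old′ v ⟶′* x
    reach′ x with oldOrNew G k x
    ... | isOld u = mk⇔ (path-old ∘ Equivalence.to (reach u) ∘ ∈-++ˡ⁻ D ⊥)
                        (∈-++ˡ⁺ ⊥ ∘ Equivalence.from (reach u) ∘ path-old⁻)
    ... | isNew b = mk⇔ (λ b∈ → contradiction (∈-++ʳ⁻ D ⊥ b∈) ∉⊥)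
                        (λ r → contradiction r old-new-unreachable)

  component-new : ∀ {b} → b ∉ B → IsComponent G′ S′ (⊥ Vec.++ ⁅ b ⁆)
  component-new {b} b∉B = new′ b , b∉B ∘ ∈-++ʳ⁻ A B , reach′
    where
    reach′ : ∀ x → x ∈ ⊥ Vec.++ ⁅ b ⁆ ⇔ new′ b ⟶′* x
    reach′ x with oldOrNew G k x
    ... | isOld u = mk⇔ (λ u∈ → contradiction (∈-++ˡ⁻ ⊥ ⁅ b ⁆ u∈) ∉⊥)
                        (λ r → contradiction (path-from-new r) (old≢new G k))
    ... | isNew a = mk⇔
      (λ a∈ → subst (λ a → new′ b ⟶′* new′ a)
        (sym (x∈⁅y⁆⇒x≡y b (∈-++ʳ⁻ {m = order G} ⊥ ⁅ b ⁆ a∈))) ε)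
      (λ r → subst (_∈ (⊥ Vec.++ ⁅ b ⁆)) (sym (path-from-new r))
        (∈-++ʳ⁺ {m = order G} ⊥ (x∈⁅x⁆ b)))

  -- The base point of the component decides the case: from an old vertex only old ones are
  -- reachable, from a new vertex only itself.
  component⁻ : ∀ X Y → IsComponent G′ S′ (X Vec.++ Y) →
               IsComponent G A X × Y ≡ ⊥ ⊎ X ≡ ⊥ × ∃[ b ] Y ≡ ⁅ b ⁆
  component⁻ X Y (x , x∉S′ , reach) with oldOrNew G k x
  ... | isOld v = inj₁
    ( (v , x∉S′ ∘ ∈-++ˡ⁺ B , λ u → mk⇔
        (path-old⁻ ∘ Equivalence.to (reach (old′ u)) ∘ ∈-++ˡ⁺ Y)
        (∈-++ˡ⁻ X Y ∘ Equivalence.from (reach (old′ u)) ∘ path-old))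
    , Empty-unique λ (b , b∈Y) →
        old-new-unreachable (Equivalence.to (reach (new′ b)) (∈-++ʳ⁺ X b∈Y)))
  ... | isNew b = inj₂
    ( Empty-unique (λ (u , u∈X) →
        old≢new G k (path-from-new (Equivalence.to (reach (old′ u)) (∈-++ˡ⁺ Y u∈X))))
    , b , ⊆-antisym
        (λ {a} a∈Y → subst (_∈ ⁅ b ⁆)
          (sym (↑ʳ-injective (order G) a b
            (path-from-new (Equivalence.to (reach (new′ a)) (∈-++ʳ⁺ X a∈Y)))))
          (x∈⁅x⁆ b))
        (λ {a} a∈ → subst (_∈ Y) (sym (x∈⁅y⁆⇒x≡y b a∈))
          (∈-++ʳ⁻ X Y (Equivalence.from (reach (new′ b)) ε))))

-- Total weights of concatenated vertex sets

measure : ∀ {n} → (Fin n → ℕ) → Subset n → ℕ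
measure f []            = 0
measure f (inside  ∷ X) = f zero + measure (f ∘ suc) X
measure f (outside ∷ X) = measure (f ∘ suc) X

-- Turns the sum over a filtered list into a recursion on the bit vector, which splits along `++`.
-- The map `h` is general because the tail of `tabulate h` is `tabulate (h ∘ suc)`: its values stay
-- in `A` while the bits move to a smaller index set.
sum-filter : ∀ {n} {A : Set} {P : A → Set} (P? : Decidable P) (f : A → ℕ) (h : Fin n → A) X →
  (∀ i → i ∈ X ⇔ P (h i)) → sum (map f (filter P? (tabulate h))) ≡ measure (f ∘ h) X
sum-filter P? f h []      X⇔P = refl
sum-filter P? f h (s ∷ X) X⇔P with P? (h zero)
    | sum-filter P? f (h ∘ suc) X (λ i → mk⇔ (Equivalence.to (X⇔P (suc i)) ∘ there)
                                             (drop-there ∘ Equivalence.from (X⇔P (suc i))))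
sum-filter P? f h (inside  ∷ X) X⇔P | yes _ | ih = cong (_ +_) ih
sum-filter P? f h (outside ∷ X) X⇔P | no _  | ih = ih
sum-filter P? f h (inside  ∷ X) X⇔P | no ¬p | _  = contradiction (Equivalence.to (X⇔P zero) here) ¬p
sum-filter P? f h (outside ∷ X) X⇔P | yes p | _  with () ← Equivalence.from (X⇔P zero) p

measure-++ : ∀ {m n} (f : Fin (m + n) → ℕ) (A : Subset m) (B : Subset n) →
  measure f (A Vec.++ B) ≡ measure (f ∘ (_↑ˡ n)) A + measure (f ∘ (m ↑ʳ_)) B
measure-++ f []            B = refl
measure-++ f (inside  ∷ A) B =
  trans (cong (f zero +_) (measure-++ (f ∘ suc) A B)) (sym (+-assoc (f zero) _ _))
measure-++ f (outside ∷ A) B = measure-++ (f ∘ suc) A B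

measure-cong : ∀ {n} {f g : Fin n → ℕ} → (∀ i → f i ≡ g i) → ∀ X → measure f X ≡ measure g X
measure-cong f≗g []            = refl
measure-cong f≗g (inside  ∷ X) = cong₂ _+_ (f≗g zero) (measure-cong (f≗g ∘ suc) X)
measure-cong f≗g (outside ∷ X) = measure-cong (f≗g ∘ suc) X

measure-* : ∀ {n} (f : Fin n → ℕ) c X → measure (λ i → f i * c) X ≡ measure f X * c
measure-* f c []            = refl
measure-* f c (inside  ∷ X) =
  trans (cong (f zero * c +_) (measure-* (f ∘ suc) c X)) (sym (*-distribʳ-+ c (f zero) _))
measure-* f c (outside ∷ X) = measure-* (f ∘ suc) c X

measure-⊥ : ∀ {n} (f : Fin n → ℕ) → measure f ⊥ ≡ 0
measure-⊥ {zero}  f = refl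
measure-⊥ {suc n} f = measure-⊥ (f ∘ suc)

measure-const : ∀ {n} c (X : Subset n) → measure (λ _ → c) X ≡ ∣ X ∣ * c
measure-const c []            = refl
measure-const c (inside  ∷ X) = cong (c +_) (measure-const c X)
measure-const c (outside ∷ X) = measure-const c X

totalWeight≡measure : ∀ W X → totalWeight W X ≡ measure (weight W) X
totalWeight≡measure W X = sum-filter (_∈? X) (weight W) id X λ i → mk⇔ id id

tabulate-+ : ∀ {A : Set} m {n} (f : Fin (m + n) → A) →
  tabulate f ≡ tabulate (f ∘ (_↑ˡ n)) ++ tabulate (f ∘ (m ↑ʳ_))
tabulate-+ zero    f = refl
tabulate-+ (suc m) f = cong (f zero ∷_) (tabulate-+ m (f ∘ suc))

tabulate-const : ∀ {A : Set} n (x : A) → tabulate {n = n} (λ _ → x) ≡ replicate n x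
tabulate-const zero    x = refl
tabulate-const (suc n) x = cong (x ∷_) (tabulate-const n x)

module Padding (W : WeightedGraph) (c L k : ℕ) (c>0 : 0 < c) (L>0 : 0 < L) where
  private n = order (graph W)

  newWeight : Fin n ⊎ Fin k → ℕ
  newWeight (inj₁ v) = weight W v * c
  newWeight (inj₂ _) = L

  padded : WeightedGraph
  padded = record
    { graph      = withIsolated (graph W) k
    ; weight     = newWeight ∘ splitAt n
    ; weight-pos = λ x → positive (splitAt n x)
    }
    where
    positive : ∀ s → 0 < newWeight s
    positive (inj₁ v) = *-mono-< (WeightedGraph.weight-pos W v) c>0
    positive (inj₂ _) = L>0

  totalWeight-padded : ∀ X Y → totalWeight padded (X Vec.++ Y) ≡ totalWeight W X * c + ∣ Y ∣ * L
  totalWeight-padded X Y = begin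
    totalWeight padded (X Vec.++ Y)
      ≡⟨ totalWeight≡measure padded (X Vec.++ Y) ⟩
    measure (weight padded) (X Vec.++ Y)
      ≡⟨ measure-++ (weight padded) X Y ⟩
    measure (weight padded ∘ (_↑ˡ k)) X + measure (weight padded ∘ (n ↑ʳ_)) Y
      ≡⟨ cong₂ _+_
           (trans (measure-cong (λ v → cong newWeight (splitAt-↑ˡ n v k)) X)
                  (measure-* (weight W) c X))
           (trans (measure-cong (λ b → cong newWeight (splitAt-↑ʳ n k b)) Y)
                  (measure-const L Y)) ⟩
    measure (weight W) X * c + ∣ Y ∣ * L
      ≡⟨ cong (λ m → m * c + ∣ Y ∣ * L) (totalWeight≡measure W X) ⟨
    totalWeight W X * c + ∣ Y ∣ * L
      ∎
    where open ≡-Reasoning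

  weights-padded : map (weight padded) (allFin (n + k)) ≡
                   map (_* c) (map (weight W) (allFin n)) ++ replicate k L
  weights-padded = begin
    map (weight padded) (allFin (n + k))
      ≡⟨ map-tabulate id (weight padded) ⟩
    tabulate (weight padded)
      ≡⟨ tabulate-+ n (weight padded) ⟩
    tabulate (weight padded ∘ (_↑ˡ k)) ++ tabulate (weight padded ∘ (n ↑ʳ_))
      ≡⟨ cong₂ _++_
           (tabulate-cong λ v → cong newWeight (splitAt-↑ˡ n v k))
           (trans (tabulate-cong λ b → cong newWeight (splitAt-↑ʳ n k b)) (tabulate-const k L)) ⟩
    tabulate (λ v → weight W v * c) ++ replicate k L
      ≡⟨ cong (_++ replicate k L)
           (trans (cong (map (_* c)) (map-tabulate id (weight W)))
                  (map-tabulate (weight W) (_* c))) ⟨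
    map (_* c) (map (weight W) (allFin n)) ++ replicate k L
      ∎
    where open ≡-Reasoning

-- Machines

pattern one = just true

module _ (M : Machine) where
  open Machine M hiding (Outputs)

  -- The index is an upper bound on the number of steps, not the exact number.
  data Halts (w : Word) : ℕ → Config → Set where
    stop : ∀ {b c} → step c ≡ nothing → Contains (outputTape c) w → Halts w b c
    next : ∀ {b c c′} → step c ≡ just c′ → Halts w b c′ → Halts w (suc b) c

  Halts-mono : ∀ {w b b′ c} → b ≤ b′ → Halts w b c → Halts w b′ c
  Halts-mono b≤b′       (stop eq out) = stop eq out
  Halts-mono (s≤s b≤b′) (next eq h)   = next eq (Halts-mono b≤b′ h)

  Halts-resp-≡ : ∀ {w w′ b c} → w ≡ w′ → Halts w b c → Halts w′ b c
  Halts-resp-≡ refl h = h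

  Halts⇒HaltsIn : ∀ {w b c} → Halts w b c →
    ∃[ t ] t ≤ b × ∃[ d ] HaltsIn t c d × Contains (outputTape d) w
  Halts⇒HaltsIn (stop eq out) = 0 , z≤n , _ , halt eq , out
  Halts⇒HaltsIn (next eq h) with Halts⇒HaltsIn h
  ... | t , t≤b , d , run , out = suc t , s≤s t≤b , d , next eq run , out

-- The output tape after writing reverse u: as u lists the most recent symbol first, writing b
-- turns u ʳ++ (b ∷ w) into (b ∷ u) ʳ++ w definitionally.
written : Word → Tape
written u = tape (map just u) blank []

contains-written : ∀ u → Contains (written u) (u ʳ++ [])
-- The single trailing blank is the cell under the head, just behind the last symbol written.
contains-written u = 0 , 1 ,
  cong (_++ [ blank ]) (trans (sym (reverse-map just u))
    (cong (map just) (trans (sym (++-identityʳ (reverse u))) (sym (ʳ++-defn u)))))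

-- The head scans the cell after c. Through move right the blank behind the last input symbol
-- is created definitionally, so v = [] needs no separate treatment.
toRead : List Cell → Cell → Word → Tape
toRead ls c v = move right (tape ls c (map just v))

keep skip back : Cell → Cell × Move
keep c = c , stay
skip c = c , right
back c = c , left

put : Bool → Cell × Move
put b = just b , right

-- A step of a counter loop stacks one more symbol onto the cells beyond the block, while the
-- invariant counts it within the block; this converts between the two views.
replicate-∷ : ∀ {A : Set} n (x : A) xs → replicate n x ++ x ∷ xs ≡ x ∷ replicate n x ++ xs
replicate-∷ zero    x xs = refl
replicate-∷ (suc n) x xs = cong (x ∷_) (replicate-∷ n x xs)

replicate-+ : ∀ {A : Set} m n (x : A) xs →
              replicate m x ++ replicate n x ++ xs ≡ replicate (m + n) x ++ xs
replicate-+ zero    n x xs = refl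
replicate-+ (suc m) n x xs = cong (x ∷_) (replicate-+ m n x xs)

encodeℕ-++ : ∀ n w → encodeℕ n ++ w ≡ replicate n true ++ false ∷ w
encodeℕ-++ n w = ++-assoc (replicate n true) _ w

replicate-encodeℕ : ∀ m n w → replicate m true ++ encodeℕ n ++ w ≡ encodeℕ (m + n) ++ w
replicate-encodeℕ m n w rewrite encodeℕ-++ n w | encodeℕ-++ (m + n) w = replicate-+ m n true _

length-encodeℕ-++ : ∀ n w → length (encodeℕ n ++ w) ≡ n + suc (length w)
length-encodeℕ-++ n w rewrite encodeℕ-++ n w | length-++ (replicate n true) {false ∷ w} =
  cong (_+ _) (length-replicate n)

module Successor where

  pattern begin = zero
  pattern copy  = suc zero

  δ : Fin 2 → Vec Cell 2 → Maybe (Fin 2 × Vec (Cell × Move) 2)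
  δ begin (i ∷ o ∷ [])      = just (copy , keep i ∷ put true ∷ [])
  δ copy  (just b ∷ o ∷ []) = just (copy , skip (just b) ∷ put b ∷ [])
  δ copy  (blank ∷ o ∷ [])  = nothing

  successor : Machine
  successor = record
    { workTapes = 0 ; State = Fin 2 ; finite = 2 , ↔-id _ ; start = begin ; δ = δ }

  copying : ∀ w ls c u →
    Halts successor (u ʳ++ w) (length w) (copy , toRead ls c w ∷ written u ∷ [])
  copying []      ls c u = stop refl (contains-written u)
  copying (b ∷ w) ls c u = next refl (copying w (c ∷ ls) (just b) (b ∷ u))

  computable : Computable suc
  computable = successor , λ n → let t , _ , run = Halts⇒HaltsIn successor (run n) in t , run
    where
    run : ∀ n → Halts successor (encodeℕ (suc n)) (suc (length (encodeℕ n)))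
                      (Machine.initial successor (encodeℕ n))
    run zero    = next refl (next refl (copying [] [] (just false) (false ∷ true ∷ [])))
    run (suc n) = next refl (next refl (copying (encodeℕ n) [] one (true ∷ true ∷ [])))

-- The machine computing the reduction

module Reduction where

  -- With m = p + 1, the tape P holds m ones, L holds ℓ m, K holds (ℓ + 1) m, the number of
  -- isolated vertices, and N holds the order of the input graph. A state with ← rewinds a
  -- counter and emits a one per step; the state with → winds it back silently. For every one
  -- of ℓ (scaleL) and of a weight (scaleW) the tape P is swept in this way, and for every one
  -- of K (copyL) the tape L is.
  State : Set
  State = Fin 15

  pattern init    = zero
  pattern readP   = suc init
  pattern readL   = suc readP
  pattern scaleL← = suc readL
  pattern scaleL→ = suc scaleL←
  pattern readN   = suc scaleL→
  pattern writeK  = suc readN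
  pattern weights = suc writeK
  pattern readW   = suc weights
  pattern scaleW← = suc readW
  pattern scaleW→ = suc scaleW←
  pattern copies  = suc scaleW→
  pattern copyL←  = suc copies
  pattern copyL→  = suc copyL←
  pattern edges   = suc copyL→

  δ : State → Vec Cell 6 → Maybe (State × Vec (Cell × Move) 6)
  -- Moving the heads leaves a blank to the left of each counter as a left end marker.
  δ init    (i ∷ o ∷ P ∷ L ∷ K ∷ N ∷ []) =
    just (readP , keep i ∷ keep o ∷ skip P ∷ skip L ∷ skip K ∷ skip N ∷ [])
  δ readP   (just true  ∷ o ∷ P ∷ L ∷ K ∷ N ∷ []) =
    just (readP , skip one ∷ put true ∷ put true ∷ keep L ∷ put true ∷ keep N ∷ [])
  -- The separator after `p` supplies the extra one of m = p + 1 on `P` and `K`. No separator is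
  -- output: the ones of ℓ m follow directly, so that p + ℓ m is emitted as one number.
  δ readP   (just false ∷ o ∷ P ∷ L ∷ K ∷ N ∷ []) =
    just (readL , skip (just false) ∷ keep o ∷ put true ∷ keep L ∷ put true ∷ keep N ∷ [])
  δ readL   (just true  ∷ o ∷ P ∷ L ∷ K ∷ N ∷ []) =
    just (scaleL← , skip one ∷ keep o ∷ back P ∷ keep L ∷ keep K ∷ keep N ∷ [])
  δ readL   (just false ∷ o ∷ P ∷ L ∷ K ∷ N ∷ []) =
    just (readN , skip (just false) ∷ put false ∷ keep P ∷ keep L ∷ keep K ∷ keep N ∷ [])
  -- `K` already holds m ones from reading `p`; m further ones for each one of ℓ bring it to (ℓ + 1)
  -- m.
  δ scaleL← (i ∷ o ∷ just b ∷ L ∷ K ∷ N ∷ []) =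
    just (scaleL← , keep i ∷ put true ∷ back (just b) ∷ put true ∷ put true ∷ keep N ∷ [])
  δ scaleL← (i ∷ o ∷ blank  ∷ L ∷ K ∷ N ∷ []) =
    just (scaleL→ , keep i ∷ keep o ∷ skip blank ∷ keep L ∷ keep K ∷ keep N ∷ [])
  δ scaleL→ (i ∷ o ∷ just b ∷ L ∷ K ∷ N ∷ []) =
    just (scaleL→ , keep i ∷ keep o ∷ skip (just b) ∷ keep L ∷ keep K ∷ keep N ∷ [])
  δ scaleL→ (i ∷ o ∷ blank  ∷ L ∷ K ∷ N ∷ []) =
    just (readL , keep i ∷ keep o ∷ keep blank ∷ keep L ∷ keep K ∷ keep N ∷ [])
  δ readN   (just true  ∷ o ∷ P ∷ L ∷ K ∷ N ∷ []) =
    just (readN , skip one ∷ put true ∷ keep P ∷ keep L ∷ keep K ∷ put true ∷ [])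
  -- Again no separator: the ones of `K` are appended to those of the order, which gives the order
  -- of the padded graph.
  δ readN   (just false ∷ o ∷ P ∷ L ∷ K ∷ N ∷ []) =
    just (writeK , skip (just false) ∷ keep o ∷ keep P ∷ keep L ∷ back K ∷ keep N ∷ [])
  δ writeK  (i ∷ o ∷ P ∷ L ∷ just b ∷ N ∷ []) =
    just (writeK , keep i ∷ put true ∷ keep P ∷ keep L ∷ back (just b) ∷ keep N ∷ [])
  -- `K` is left at its first one and `N` at its last, since `copies` consumes its counter
  -- rightwards and `weights` leftwards.
  δ writeK  (i ∷ o ∷ P ∷ L ∷ blank  ∷ N ∷ []) =
    just (weights , keep i ∷ put false ∷ keep P ∷ keep L ∷ skip blank ∷ back N ∷ [])
  δ weights (i ∷ o ∷ P ∷ L ∷ K ∷ just b ∷ []) =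
    just (readW , keep i ∷ keep o ∷ keep P ∷ keep L ∷ keep K ∷ back (just b) ∷ [])
  δ weights (i ∷ o ∷ P ∷ L ∷ K ∷ blank  ∷ []) =
    just (copies , keep i ∷ keep o ∷ keep P ∷ keep L ∷ keep K ∷ keep blank ∷ [])
  δ readW   (just true  ∷ o ∷ P ∷ L ∷ K ∷ N ∷ []) =
    just (scaleW← , skip one ∷ keep o ∷ back P ∷ keep L ∷ keep K ∷ keep N ∷ [])
  δ readW   (just false ∷ o ∷ P ∷ L ∷ K ∷ N ∷ []) =
    just (weights , skip (just false) ∷ put false ∷ keep P ∷ keep L ∷ keep K ∷ keep N ∷ [])
  δ scaleW← (i ∷ o ∷ just b ∷ L ∷ K ∷ N ∷ []) =
    just (scaleW← , keep i ∷ put true ∷ back (just b) ∷ keep L ∷ keep K ∷ keep N ∷ [])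
  δ scaleW← (i ∷ o ∷ blank  ∷ L ∷ K ∷ N ∷ []) =
    just (scaleW→ , keep i ∷ keep o ∷ skip blank ∷ keep L ∷ keep K ∷ keep N ∷ [])
  δ scaleW→ (i ∷ o ∷ just b ∷ L ∷ K ∷ N ∷ []) =
    just (scaleW→ , keep i ∷ keep o ∷ skip (just b) ∷ keep L ∷ keep K ∷ keep N ∷ [])
  δ scaleW→ (i ∷ o ∷ blank  ∷ L ∷ K ∷ N ∷ []) =
    just (readW , keep i ∷ keep o ∷ keep blank ∷ keep L ∷ keep K ∷ keep N ∷ [])
  δ copies  (i ∷ o ∷ P ∷ L ∷ just b ∷ N ∷ []) =
    just (copyL← , keep i ∷ keep o ∷ keep P ∷ back L ∷ skip (just b) ∷ keep N ∷ [])
  δ copies  (i ∷ o ∷ P ∷ L ∷ blank  ∷ N ∷ []) =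
    just (edges , keep i ∷ keep o ∷ keep P ∷ keep L ∷ keep blank ∷ keep N ∷ [])
  δ copyL←  (i ∷ o ∷ P ∷ just b ∷ K ∷ N ∷ []) =
    just (copyL← , keep i ∷ put true ∷ keep P ∷ back (just b) ∷ keep K ∷ keep N ∷ [])
  δ copyL←  (i ∷ o ∷ P ∷ blank  ∷ K ∷ N ∷ []) =
    just (copyL→ , keep i ∷ keep o ∷ keep P ∷ skip blank ∷ keep K ∷ keep N ∷ [])
  δ copyL→  (i ∷ o ∷ P ∷ just b ∷ K ∷ N ∷ []) =
    just (copyL→ , keep i ∷ keep o ∷ keep P ∷ skip (just b) ∷ keep K ∷ keep N ∷ [])
  δ copyL→  (i ∷ o ∷ P ∷ blank  ∷ K ∷ N ∷ []) =
    just (copies , keep i ∷ put false ∷ keep P ∷ keep blank ∷ keep K ∷ keep N ∷ [])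
  δ edges   (just b ∷ o ∷ P ∷ L ∷ K ∷ N ∷ []) =
    just (edges , skip (just b) ∷ put b ∷ keep P ∷ keep L ∷ keep K ∷ keep N ∷ [])
  δ _       _ = nothing

  machine : Machine
  machine = record
    { workTapes = 4 ; State = State ; finite = 15 , ↔-id _ ; start = init ; δ = δ }

  -- From state q with v left to read, the machine still has to write w within b steps.
  Writes : ℕ → State → Word → (P L K N : Tape) → Word → Set
  Writes b q v P L K N w = ∀ ls c u →
    Halts machine (u ʳ++ w) b (q , toRead ls c v ∷ written u ∷ P ∷ L ∷ K ∷ N ∷ [])

  private variable
    b     : ℕ
    q     : State
    v w   : Word
    P L K N : Tape

  ones : ℕ → List Cell → List Cell
  ones n ls = replicate n one ++ ls

  counter : ℕ → Tape
  counter n = tape (ones n [ blank ]) blank []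

  -- Phrased as a move just made, as is `forward`, so that the scanned cell computes to a one or,
  -- for `n` zero, to the blank end marker.
  rewind : ℕ → Cell → List Cell → Tape
  rewind n c rs = move left (tape (ones n [ blank ]) c rs)

  forward : ℕ → Cell → List Cell → Tape
  forward n c ls = move right (tape ls c (ones n [ blank ]))

  -- Correctness and cost of the phases, from the last to the first

  edges-writes : ∀ w → Writes (length w) edges w P L K N w
  edges-writes []      ls c u = stop refl (contains-written u)
  edges-writes (x ∷ w) ls c u = next refl (edges-writes w (c ∷ ls) (just x) (x ∷ u))

  -- Continuation style, as in all phases: `h` describes the run after the loop, to which the loop
  -- prepends its own steps and output.
  copyL→-writes : ∀ n {c₀ ls₀} →
    Writes b copies v P (tape (ones n (c₀ ∷ ls₀)) blank []) K N w →
    Writes (n + suc b) copyL→ v P (forward n c₀ ls₀) K N (false ∷ w)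
  copyL→-writes zero    h ls c u = next refl (h ls c (false ∷ u))
  copyL→-writes (suc n) {c₀} {ls₀} h rewrite sym (replicate-∷ n one (c₀ ∷ ls₀)) =
    λ ls c u → next refl (copyL→-writes n h ls c u)

  copyL←-writes : ∀ n {c₀ rs₀} →
    Writes b copyL← v P (tape [] blank (ones n (c₀ ∷ rs₀))) K N w →
    Writes (n + b) copyL← v P (rewind n c₀ rs₀) K N (replicate n true ++ w)
  copyL←-writes zero    h = h
  copyL←-writes (suc n) {c₀} {rs₀} h rewrite sym (replicate-∷ n one (c₀ ∷ rs₀)) =
    λ ls c u → next refl (copyL←-writes n h ls c (true ∷ u))

  copyL-writes : ∀ m → Writes b copies v P (counter m) K N w →
    Writes (m + suc (m + suc b)) copyL← v P (rewind m blank []) K N (encodeℕ m ++ w)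
  copyL-writes {w = w} m h rewrite encodeℕ-++ m w =
    copyL←-writes m λ ls c u → next refl (copyL→-writes m h ls c u)

  -- One sweep costs 3 + 2m steps: m in each direction, one to start, one to turn and one to return.
  sweep-time : ∀ m x b → suc (m + suc (m + suc (x + suc b))) ≡ (3 + m + m + x) + suc b
  sweep-time = solve-∀

  copies-writes : ∀ m k {c₀ ls₀} →
    (∀ K → Writes b edges v P (counter m) K N w) →
    Writes (k * (3 + m + m) + suc b) copies v P (counter m) (forward k c₀ ls₀) N
      (concatMap encodeℕ (replicate k m) ++ w)
  copies-writes m zero    h ls c u = next refl (h _ ls c u)
  copies-writes {b = b} {w = w} m (suc k) h
    rewrite ++-assoc (encodeℕ m) (concatMap encodeℕ (replicate k m)) w =
    λ ls c u → Halts-mono machine (≤-reflexive (sweep-time m (k * (3 + m + m)) b))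
      (next refl (copyL-writes m (copies-writes m k h) ls c u))

  scaleW→-writes : ∀ n {c₀ ls₀} →
    Writes b readW v (tape (ones n (c₀ ∷ ls₀)) blank []) L K N w →
    Writes (n + suc b) scaleW→ v (forward n c₀ ls₀) L K N w
  scaleW→-writes zero    h ls c u = next refl (h ls c u)
  scaleW→-writes (suc n) {c₀} {ls₀} h rewrite sym (replicate-∷ n one (c₀ ∷ ls₀)) =
    λ ls c u → next refl (scaleW→-writes n h ls c u)

  scaleW←-writes : ∀ n {c₀ rs₀} →
    Writes b scaleW← v (tape [] blank (ones n (c₀ ∷ rs₀))) L K N w →
    Writes (n + b) scaleW← v (rewind n c₀ rs₀) L K N (replicate n true ++ w)
  scaleW←-writes zero    h = h
  scaleW←-writes (suc n) {c₀} {rs₀} h rewrite sym (replicate-∷ n one (c₀ ∷ rs₀)) =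
    λ ls c u → next refl (scaleW←-writes n h ls c (true ∷ u))

  readW-writes : ∀ m n → Writes b weights v (counter m) L K N w →
    Writes (n * (3 + m + m) + suc b) readW (encodeℕ n ++ v) (counter m) L K N
      (encodeℕ (n * m) ++ w)
  readW-writes m zero    h ls c u = next refl (h (c ∷ ls) (just false) (false ∷ u))
  readW-writes {b = b} {v = v} {w = w} m (suc n) h
    rewrite sym (replicate-encodeℕ m (n * m) w) =
    λ ls c u → Halts-mono machine (≤-reflexive (sweep-time m (n * (3 + m + m)) b))
      (next refl (scaleW←-writes {v = encodeℕ n ++ v} m
        (λ ls c u → next refl (scaleW→-writes m (readW-writes m n h) ls c u)) (c ∷ ls) one u))

  -- The cost is charged to the encoded length: each one of a weight pays for its sweep, and the
  -- separator is charged a full round although it accounts for two steps only. Hence the slack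
  -- `1 + m + m`. Quantifying `h` over the exhausted counter avoids computing its final contents.
  weights-writes : ∀ m ws {c₀ rs₀} →
    (∀ N → Writes b copies v (counter m) L K N w) →
    Writes (length (concatMap encodeℕ ws) * (3 + m + m) + suc b) weights
      (concatMap encodeℕ ws ++ v) (counter m) L K (rewind (length ws) c₀ rs₀)
      (concatMap encodeℕ (map (_* m) ws) ++ w)
  weights-writes m []       h ls c u = next refl (h _ ls c u)
  weights-writes {b = b} {v = v} {w = w} m (x ∷ ws) h
    rewrite ++-assoc (encodeℕ x) (concatMap encodeℕ ws) v
          | ++-assoc (encodeℕ (x * m)) (concatMap encodeℕ (map (_* m) ws)) w =
    λ ls c u → Halts-mono machine bound
      (next refl (readW-writes m x (weights-writes m ws h) ls c u))
    where
    s y : ℕ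
    s = 3 + m + m
    y = length (concatMap encodeℕ ws)
    open ≤-Reasoning
    lemma : ∀ x y m b → 2 + (x * (3 + m + m) + (y * (3 + m + m) + suc b)) + (1 + m + m) ≡
                        (x + (1 + y)) * (3 + m + m) + suc b
    lemma = solve-∀
    bound : suc (x * s + suc (y * s + suc b)) ≤
            length (encodeℕ x ++ concatMap encodeℕ ws) * s + suc b
    bound = begin
      suc (x * s + suc (y * s + suc b))           ≡⟨ cong suc (+-suc (x * s) _) ⟩
      2 + (x * s + (y * s + suc b))               ≤⟨ m≤m+n _ (1 + m + m) ⟩
      2 + (x * s + (y * s + suc b)) + (1 + m + m) ≡⟨ lemma x y m b ⟩
      (x + (1 + y)) * s + suc b
        ≡⟨ cong (λ l → l * s + suc b) (length-encodeℕ-++ x _) ⟨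
      length (encodeℕ x ++ concatMap encodeℕ ws) * s + suc b ∎

  writeK-writes : ∀ n {c₀ rs₀} →
    Writes b writeK v P L (tape [] blank (ones n (c₀ ∷ rs₀))) N w →
    Writes (n + b) writeK v P L (rewind n c₀ rs₀) N (replicate n true ++ w)
  writeK-writes zero    h = h
  writeK-writes (suc n) {c₀} {rs₀} h rewrite sym (replicate-∷ n one (c₀ ∷ rs₀)) =
    λ ls c u → next refl (writeK-writes n h ls c (true ∷ u))

  encodeK-writes : ∀ k → Writes b weights v P L (forward k blank []) (move left N) w →
    Writes (k + suc b) writeK v P L (rewind k blank []) N (encodeℕ k ++ w)
  encodeK-writes {w = w} k h rewrite encodeℕ-++ k w =
    writeK-writes k λ ls c u → next refl (h ls c (false ∷ u))

  readN-writes : ∀ n {ns} →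
    Writes b writeK v P L (move left K) (tape (ones n ns) blank []) w →
    Writes (n + suc b) readN (encodeℕ n ++ v) P L K (tape ns blank []) (replicate n true ++ w)
  readN-writes zero         h ls c u = next refl (h (c ∷ ls) (just false) u)
  readN-writes (suc n) {ns} h rewrite sym (replicate-∷ n one ns) =
    λ ls c u → next refl (readN-writes n h (c ∷ ls) one (true ∷ u))

  scaleL→-writes : ∀ n {c₀ ls₀} →
    Writes b readL v (tape (ones n (c₀ ∷ ls₀)) blank []) L K N w →
    Writes (n + suc b) scaleL→ v (forward n c₀ ls₀) L K N w
  scaleL→-writes zero    h ls c u = next refl (h ls c u)
  scaleL→-writes (suc n) {c₀} {ls₀} h rewrite sym (replicate-∷ n one (c₀ ∷ ls₀)) =
    λ ls c u → next refl (scaleL→-writes n h ls c u)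

  scaleL←-writes : ∀ n {c₀ rs₀ l k} →
    Writes b scaleL← v (tape [] blank (ones n (c₀ ∷ rs₀)))
      (tape (ones n l) blank []) (tape (ones n k) blank []) N w →
    Writes (n + b) scaleL← v (rewind n c₀ rs₀)
      (tape l blank []) (tape k blank []) N (replicate n true ++ w)
  scaleL←-writes zero    h = h
  scaleL←-writes (suc n) {c₀} {rs₀} {l} {k} h
    rewrite sym (replicate-∷ n one (c₀ ∷ rs₀))
          | sym (replicate-∷ n one l) | sym (replicate-∷ n one k) =
    λ ls c u → next refl (scaleL←-writes n h ls c (true ∷ u))

  -- `suc ℓ * m` unfolds with `m` outermost, whereas the sweep for the first one of `ℓ` puts its `m`
  -- ones at the bottom of the stack.
  ones-swap : ∀ m n ls → ones (m + n) ls ≡ ones n (ones m ls)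
  ones-swap m n ls rewrite +-comm m n = sym (replicate-+ n m one ls)

  readL-writes : ∀ m ℓ {l k} →
    Writes b readN v (counter m)
      (tape (ones (ℓ * m) l) blank []) (tape (ones (ℓ * m) k) blank []) N w →
    Writes (ℓ * (3 + m + m) + suc b) readL (encodeℕ ℓ ++ v) (counter m)
      (tape l blank []) (tape k blank []) N (encodeℕ (ℓ * m) ++ w)
  readL-writes m zero    h ls c u = next refl (h (c ∷ ls) (just false) (false ∷ u))
  readL-writes {b = b} {v = v} {w = w} m (suc ℓ) {l} {k} h
    rewrite ones-swap m (ℓ * m) l | ones-swap m (ℓ * m) k
          | sym (replicate-encodeℕ m (ℓ * m) w) =
    λ ls c u → Halts-mono machine (≤-reflexive (sweep-time m (ℓ * (3 + m + m)) b))
      (next refl (scaleL←-writes {v = encodeℕ ℓ ++ v} m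
        (λ ls c u → next refl (scaleL→-writes m (readL-writes m ℓ h) ls c u)) (c ∷ ls) one u))

  readP-writes : ∀ p {m k} →
    Writes b readL v (tape (ones (suc p) m) blank []) L (tape (ones (suc p) k) blank []) N w →
    Writes (p + suc b) readP (encodeℕ p ++ v) (tape m blank []) L (tape k blank []) N
      (replicate p true ++ w)
  readP-writes zero h ls c u = next refl (h (c ∷ ls) (just false) u)
  readP-writes (suc p) {m} {k} h
    rewrite sym (replicate-∷ p one m) | sym (replicate-∷ p one k) =
    λ ls c u → next refl (readP-writes p h (c ∷ ls) one (true ∷ u))

  -- `toRead` presupposes a cell already passed, but the head starts on the first symbol of the
  -- input; hence this symbol is read by hand, in two cases.
  init-halts : ∀ p →
    Writes b readL v (counter (suc p)) (counter 0) (counter (suc p)) (counter 0) w →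
    Halts machine (replicate p true ++ w) (suc (p + suc b))
      (Machine.initial machine (encodeℕ p ++ v))
  init-halts zero    h = next refl (next refl (h [] (just false) []))
  init-halts (suc p) h rewrite sym (replicate-∷ p one [ blank ]) =
    next refl (next refl (readP-writes p h [] one (true ∷ [])))

  -- The nesting repeats the bounds of the phases in order of execution and so agrees definitionally
  -- with the bound they compose to.
  time : (p ℓ : ℕ) (ws : List ℕ) (es : Word) → ℕ
  time p ℓ ws es =
    suc (p + suc (ℓ * (3 + m + m) + suc (length ws + suc (k + suc (
      length (concatMap encodeℕ ws) * (3 + m + m) + suc (
      k * (3 + ℓ * m + ℓ * m) + suc (length es)))))))
    where
    m k : ℕ
    m = suc p
    k = suc ℓ * m

  machine-halts : ∀ p ℓ ws es → let m = suc p ; k = suc ℓ * m in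
    Halts machine
      (encodeℕ (p + ℓ * m) ++ encodeℕ (length ws + k) ++ concatMap encodeℕ (map (_* m) ws) ++
       concatMap encodeℕ (replicate k (ℓ * m)) ++ es)
      (time p ℓ ws es)
      (Machine.initial machine
        (encodeℕ p ++ encodeℕ ℓ ++ encodeℕ (length ws) ++ concatMap encodeℕ ws ++ es))
  machine-halts p ℓ ws es =
    Halts-resp-≡ machine word (init-halts p (readL-writes m ℓ read))
    where
    m k : ℕ
    m = suc p
    k = suc ℓ * m
    tail : Word
    tail = concatMap encodeℕ (map (_* m) ws) ++ concatMap encodeℕ (replicate k (ℓ * m)) ++ es
    word : replicate p true ++ encodeℕ (ℓ * m) ++ replicate (length ws) true ++ encodeℕ k ++ tail ≡
           encodeℕ (p + ℓ * m) ++ encodeℕ (length ws + k) ++ tail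
    word = trans (replicate-encodeℕ p (ℓ * m) _)
                 (cong (encodeℕ (p + ℓ * m) ++_) (replicate-encodeℕ (length ws) k tail))
    read : Writes _ readN (encodeℕ (length ws) ++ concatMap encodeℕ ws ++ es)
             (counter m) (counter (ℓ * m)) (tape (ones (ℓ * m) (ones m [ blank ])) blank [])
             (counter 0)
             (replicate (length ws) true ++ encodeℕ k ++ tail)
    -- On `K` the `m` ones from reading `p` and the `ℓ * m` ones from scaling merge into one counter
    -- of length `k`.
    read rewrite sym (ones-swap m (ℓ * m) [ blank ]) =
      readN-writes (length ws) (encodeK-writes k
        (weights-writes m ws (λ N → copies-writes (ℓ * m) k (λ K → edges-writes es))))

ends : ∀ {n} → Fin n × Fin n → List ℕ
ends (u , v) = toℕ u ∷ toℕ v ∷ []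

ends-oldEdge : ∀ (G : Graph) k es → concatMap ends (map (oldEdge G k) es) ≡ concatMap ends es
ends-oldEdge G k []             = refl
ends-oldEdge G k ((u , v) ∷ es) =
  cong₂ _∷_ (toℕ-↑ˡ u k) (cong₂ _∷_ (toℕ-↑ˡ v k) (ends-oldEdge G k es))

-- Polynomial bound on the running time

length-source : ∀ p ℓ ws es →
  length (encodeℕ p ++ encodeℕ ℓ ++ encodeℕ (length ws) ++ concatMap encodeℕ ws ++ es) ≡
  suc p + (suc ℓ + (suc (length ws) + (length (concatMap encodeℕ ws) + length es)))
length-source p ℓ ws es
  rewrite length-encodeℕ-++ p (encodeℕ ℓ ++ encodeℕ (length ws) ++ concatMap encodeℕ ws ++ es)
        | length-encodeℕ-++ ℓ (encodeℕ (length ws) ++ concatMap encodeℕ ws ++ es)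
        | length-encodeℕ-++ (length ws) (concatMap encodeℕ ws ++ es)
        | length-++ (concatMap encodeℕ ws) {es} =
    lemma p ℓ (length ws) (length (concatMap encodeℕ ws) + length es)
  where
  lemma : ∀ p ℓ n x → p + suc (ℓ + suc (n + suc x)) ≡ suc p + (suc ℓ + (suc n + x))
  lemma = solve-∀

-- Bounds the running time on inputs of length M: there m = p + 1 and ℓ + 1 are at most M,
-- and (ℓ + 1) m is at most M².
timePolynomial : ℕ → ℕ
timePolynomial M = suc (M + suc (M * (3 + M + M) + suc (M + suc (M * M + suc (
  M * (3 + M + M) + suc (M * M * (3 + M * M + M * M) + suc M))))))

-- With M = 3 + r the left side is 2M⁴ + 8M² + 9M + 7, and its difference from M⁶ has nonnegative
-- coefficients in r, listed here in Horner form. At M = 3 the left side is 268, above 3⁵ = 243,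
-- which is where the exponent 6 comes from.
timePolynomial≤ : ∀ r → timePolynomial (3 + r) ≤ (3 + r) ^ 6
timePolynomial≤ r = begin
  timePolynomial (3 + r) ≡⟨ collect (3 + r) ⟩
  7 + (3 + r) * (9 + (3 + r) * (8 + (3 + r) * ((3 + r) * 2))) ≤⟨ m≤m+n _ _ ⟩
  7 + (3 + r) * (9 + (3 + r) * (8 + (3 + r) * ((3 + r) * 2))) +
    (461 + r * (1185 + r * (1099 + r * (516 + r * (133 + r * (18 + r)))))) ≡⟨ expand r ⟩
  (3 + r) ^ 6 ∎
  where
  open ≤-Reasoning
  collect : ∀ M → suc (M + suc (M * (3 + M + M) + suc (M + suc (M * M + suc (
    M * (3 + M + M) + suc (M * M * (3 + M * M + M * M) + suc M)))))) ≡
    7 + M * (9 + M * (8 + M * (M * 2)))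
  collect = solve-∀
  expand : ∀ r → 7 + (3 + r) * (9 + (3 + r) * (8 + (3 + r) * ((3 + r) * 2))) +
    (461 + r * (1185 + r * (1099 + r * (516 + r * (133 + r * (18 + r)))))) ≡
    (3 + r) * ((3 + r) * ((3 + r) * ((3 + r) * ((3 + r) * ((3 + r) * 1)))))
  expand = solve-∀

time≤ : ∀ p ℓ ws es → Reduction.time p ℓ ws es ≤
  length (encodeℕ p ++ encodeℕ ℓ ++ encodeℕ (length ws) ++ concatMap encodeℕ ws ++ es) ^ 6
time≤ p ℓ ws es = ≤-trans bound
  (subst (λ x → timePolynomial M ≤ x ^ 6) (sym length-eq) (timePolynomial≤ r))
  where
  n x e r M : ℕ
  n = length ws
  x = length (concatMap encodeℕ ws)
  e = length es
  r = p + (ℓ + (n + (x + e)))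
  -- The 3 counts the separators after `p`, `ℓ` and the order; those of the weights and edges are
  -- included in `x` and `e`.
  M = 3 + r
  lemma : ∀ p ℓ n x → suc p + (suc ℓ + (suc n + x)) ≡ 3 + (p + (ℓ + (n + x)))
  lemma = solve-∀
  length-eq :
    length (encodeℕ p ++ encodeℕ ℓ ++ encodeℕ (length ws) ++ concatMap encodeℕ ws ++ es) ≡ M
  length-eq = trans (length-source p ℓ ws es) (lemma p ℓ n (x + e))
  r≤M : r ≤ M
  r≤M = m≤n+m r 3
  p≤r = m≤m+n p (ℓ + (n + (x + e)))
  ℓ≤r = ≤-trans (m≤m+n ℓ (n + (x + e))) (m≤n+m _ p)
  n≤r = ≤-trans (m≤m+n n (x + e)) (≤-trans (m≤n+m _ ℓ) (m≤n+m _ p))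
  x≤r = ≤-trans (m≤m+n x e) (≤-trans (m≤n+m _ n) (≤-trans (m≤n+m _ ℓ) (m≤n+m _ p)))
  e≤r = ≤-trans (m≤n+m e x) (≤-trans (m≤n+m _ n) (≤-trans (m≤n+m _ ℓ) (m≤n+m _ p)))
  m≤M : suc p ≤ M
  m≤M = s≤s (≤-trans p≤r (m≤n+m r 2))
  sℓ≤M : suc ℓ ≤ M
  sℓ≤M = s≤s (≤-trans ℓ≤r (m≤n+m r 2))
  up : ∀ {y} → y ≤ r → y ≤ M
  up y≤r = ≤-trans y≤r r≤M
  k≤ : suc ℓ * suc p ≤ M * M
  k≤ = *-mono-≤ sℓ≤M m≤M
  L≤ : ℓ * suc p ≤ M * M
  L≤ = *-mono-≤ (up ℓ≤r) m≤M
  scale≤ : ∀ {y z} → y ≤ z → 3 + y + y ≤ 3 + z + z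
  scale≤ y≤z = +-mono-≤ (+-monoʳ-≤ 3 y≤z) y≤z
  bound : Reduction.time p ℓ ws es ≤ timePolynomial M
  bound = s≤s (+-mono-≤ (up p≤r) (s≤s (+-mono-≤ (*-mono-≤ (up ℓ≤r) (scale≤ m≤M)) (s≤s
    (+-mono-≤ (up n≤r) (s≤s (+-mono-≤ k≤ (s≤s (+-mono-≤ (*-mono-≤ (up x≤r) (scale≤ m≤M)) (s≤s
      (+-mono-≤ (*-mono-≤ k≤ (scale≤ L≤)) (s≤s (up e≤r)))))))))))))

-- The reduction

module FromCOC (I : COCInstance) where
  open COCInstance I renaming (input to W)

  n c k : ℕ
  n = order (graph W)
  c = suc p
  k = suc ℓ * c

  L>0 : 0 < ℓ * c
  L>0 = *-mono-< ℓ-pos (s≤s z≤n)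

  open Padding W c (ℓ * c) k (s≤s z≤n) L>0

  target : VIInstance
  target = record { input = padded ; ℓ = p + ℓ * c ; ℓ-pos = ≤-trans p-pos (m≤m+n p (ℓ * c)) }

  open ParameterizedProblem

  -- The two summands are bounded separately, the deleted set by p and every component by ℓ c; an
  -- isolated vertex has the largest weight that this permits.
  yes⁺ : Yes SemiWeightedCOC I → Yes SemiWeightedVI target
  yes⁺ (S , ∣S∣≤p , small) = S Vec.++ ⊥ , ≤-trans ∣S++⊥∣≤p (m≤m+n p (ℓ * c)) , small′
    where
    open ≤-Reasoning
    ∣S++⊥∣≤p : ∣ S Vec.++ ⊥ {k} ∣ ≤ p
    ∣S++⊥∣≤p = begin
      ∣ S Vec.++ ⊥ {k} ∣     ≡⟨ ∣++∣ S (⊥ {k}) ⟩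
      ∣ S ∣ + ∣ ⊥ {k} ∣      ≡⟨ cong (∣ S ∣ +_) (∣⊥∣≡0 k) ⟩
      ∣ S ∣ + 0              ≡⟨ +-identityʳ ∣ S ∣ ⟩
      ∣ S ∣                  ≤⟨ ∣S∣≤p ⟩
      p                      ∎
    light : ∀ X Y → IsComponent (graph padded) (S Vec.++ ⊥) (X Vec.++ Y) →
            totalWeight W X * c + ∣ Y ∣ * (ℓ * c) ≤ ℓ * c
    light X Y D with component⁻ (graph W) k S ⊥ X Y D
    ... | inj₁ (D′ , refl) = begin
      totalWeight W X * c + ∣ ⊥ {k} ∣ * (ℓ * c)
        ≡⟨ cong (λ x → totalWeight W X * c + x * (ℓ * c)) (∣⊥∣≡0 k) ⟩
      totalWeight W X * c + 0                   ≡⟨ +-identityʳ _ ⟩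
      totalWeight W X * c                       ≤⟨ *-monoˡ-≤ c (small X D′) ⟩
      ℓ * c                                     ∎
    ... | inj₂ (refl , b , refl) = begin
      totalWeight W (⊥ {n}) * c + ∣ ⁅ b ⁆ ∣ * (ℓ * c)
        ≡⟨ cong₂ (λ x y → x * c + y * (ℓ * c)) totalWeight-⊥ (∣⁅x⁆∣≡1 b) ⟩
      1 * (ℓ * c) ≡⟨ *-identityˡ (ℓ * c) ⟩
      ℓ * c ∎
      where
      totalWeight-⊥ : totalWeight W ⊥ ≡ 0
      totalWeight-⊥ = trans (totalWeight≡measure W ⊥) (measure-⊥ (weight W))
    small′ : ∀ D → IsComponent (graph padded) (S Vec.++ ⊥) D →
             ∣ S Vec.++ ⊥ {k} ∣ + totalWeight padded D ≤ p + ℓ * c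
    small′ D comp with Vec.splitAt n D
    ... | X , Y , refl = +-mono-≤ ∣S++⊥∣≤p
      (subst (_≤ ℓ * c) (sym (totalWeight-padded X Y)) (light X Y comp))

  yes⁻ : Yes SemiWeightedVI target → Yes SemiWeightedCOC I
  yes⁻ (S′ , ∣S′∣≤ℓ′ , small) with Vec.splitAt n S′
  ... | A , B , refl = A , ≤-trans ∣A∣≤∣S′∣ ∣S′∣≤p , small′
    where
    open ≤-Reasoning
    ∣A∣≤∣S′∣ : ∣ A ∣ ≤ ∣ A Vec.++ B ∣
    ∣A∣≤∣S′∣ = subst (∣ A ∣ ≤_) (sym (∣++∣ A B)) (m≤m+n ∣ A ∣ ∣ B ∣)
    ∣B∣<k : ∣ B ∣ < k
    -- `suc ℓ * c` computes to `suc (p + ℓ * c)`, so the size bound on S′ alone leaves a new vertex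
    -- undeleted.
    ∣B∣<k = s≤s (≤-trans (subst (∣ B ∣ ≤_) (sym (∣++∣ A B)) (m≤n+m ∣ B ∣ ∣ A ∣)) ∣S′∣≤ℓ′)
    ∣S′∣≤p : ∣ A Vec.++ B ∣ ≤ p
    ∣S′∣≤p with ∃-∉ B ∣B∣<k
    ... | b , b∉B = +-cancelʳ-≤ (ℓ * c) _ p (begin
      ∣ A Vec.++ B ∣ + ℓ * c
        ≡⟨ cong (∣ A Vec.++ B ∣ +_) (*-identityˡ (ℓ * c)) ⟨
      ∣ A Vec.++ B ∣ + 1 * (ℓ * c)
        ≡⟨ cong (λ x → ∣ A Vec.++ B ∣ + x * (ℓ * c)) (∣⁅x⁆∣≡1 b) ⟨
      ∣ A Vec.++ B ∣ + ∣ ⁅ b ⁆ ∣ * (ℓ * c)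
        ≤⟨ +-monoʳ-≤ ∣ A Vec.++ B ∣ (m≤n+m _ (totalWeight W ⊥ * c)) ⟩
      ∣ A Vec.++ B ∣ + (totalWeight W ⊥ * c + ∣ ⁅ b ⁆ ∣ * (ℓ * c))
        ≡⟨ cong (∣ A Vec.++ B ∣ +_) (totalWeight-padded ⊥ ⁅ b ⁆) ⟨
      ∣ A Vec.++ B ∣ + totalWeight padded (⊥ {n} Vec.++ ⁅ b ⁆)
        ≤⟨ small _ (component-new (graph W) k A B b∉B) ⟩
      p + ℓ * c
        ∎)
    small′ : ∀ D → IsComponent (graph W) A D → totalWeight W D ≤ ℓ
    -- By the same computation the inner `s≤s` yields a strict inequality between multiples of `c`,
    -- from which `c` cancels.
    small′ D comp = s≤s⁻¹ (*-cancelʳ-< c _ (suc ℓ) (s≤s (begin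
      totalWeight W D * c
        ≤⟨ m≤m+n _ _ ⟩
      totalWeight W D * c + ∣ ⊥ {k} ∣ * (ℓ * c)
        ≡⟨ totalWeight-padded D ⊥ ⟨
      totalWeight padded (D Vec.++ ⊥ {k})
        ≤⟨ m≤n+m _ ∣ A Vec.++ B ∣ ⟩
      ∣ A Vec.++ B ∣ + totalWeight padded (D Vec.++ ⊥ {k})
        ≤⟨ small _ (component-old (graph W) k A B comp) ⟩
      p + ℓ * c
        ∎)))

  ws : List ℕ
  ws = map (weight W) (allFin n)

  es : List ℕ
  es = concatMap ends (Graph.edges (graph W))

  length-ws : length ws ≡ n
  length-ws = trans (length-map (weight W) (allFin n)) (length-tabulate id)

  -- The order appears as `length ws` because the machine reads one weight for each one of the
  -- order.
  source : Word
  source =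
    encodeℕ p ++ encodeℕ ℓ ++ encodeℕ (length ws) ++ concatMap encodeℕ ws ++ concatMap encodeℕ es

  source-encode : source ≡ encode SemiWeightedCOC I
  source-encode = cong₂ (λ m w → encodeℕ p ++ encodeℕ ℓ ++ encodeℕ m ++ w)
    length-ws (sym (concatMap-++ encodeℕ ws es))

  target-encode :
    encodeℕ (p + ℓ * c) ++ encodeℕ (length ws + k) ++ concatMap encodeℕ (map (_* c) ws) ++
      concatMap encodeℕ (replicate k (ℓ * c)) ++ concatMap encodeℕ es ≡
    encode SemiWeightedVI target
  target-encode = cong₂ (λ m w → encodeℕ (p + ℓ * c) ++ encodeℕ (m + k) ++ w) length-ws (begin
    concatMap encodeℕ (map (_* c) ws) ++
      concatMap encodeℕ (replicate k (ℓ * c)) ++ concatMap encodeℕ es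
      ≡⟨ cong (concatMap encodeℕ (map (_* c) ws) ++_)
           (concatMap-++ encodeℕ (replicate k (ℓ * c)) es) ⟨
    concatMap encodeℕ (map (_* c) ws) ++ concatMap encodeℕ (replicate k (ℓ * c) ++ es)
      ≡⟨ concatMap-++ encodeℕ (map (_* c) ws) _ ⟨
    concatMap encodeℕ (map (_* c) ws ++ replicate k (ℓ * c) ++ es)
      ≡⟨ cong (concatMap encodeℕ) (++-assoc (map (_* c) ws) _ es) ⟨
    concatMap encodeℕ ((map (_* c) ws ++ replicate k (ℓ * c)) ++ es)
      ≡⟨ cong₂ (λ x y → concatMap encodeℕ (x ++ y)) weights-padded
           (ends-oldEdge (graph W) k (Graph.edges (graph W))) ⟨
    concatMap encodeℕ
      (map (weight padded) (allFin (n + k)) ++ concatMap ends (Graph.edges (graph padded))) ∎)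
    where
    open ≡-Reasoning

  reduction-run : ∃[ t ] t ≤ length (encode SemiWeightedCOC I) ^ 6 ×
    Outputs Reduction.machine (encode SemiWeightedCOC I) t (encode SemiWeightedVI target)
  reduction-run = subst₂ (λ v w → ∃[ t ] t ≤ length v ^ 6 × Outputs Reduction.machine v t w)
    source-encode target-encode
    (let t , t≤time , output = Halts⇒HaltsIn Reduction.machine
           (Reduction.machine-halts p ℓ ws (concatMap encodeℕ es))
     in t , ≤-trans t≤time (time≤ p ℓ ws (concatMap encodeℕ es)) , output)

theorem4 : FptReduction SemiWeightedCOC SemiWeightedVI
theorem4 = record
  { reduce       = FromCOC.target
  ; correct      = λ I → mk⇔ (FromCOC.yes⁺ I) (FromCOC.yes⁻ I)
  ; machine      = Reduction.machine
  ; time         = λ I → proj₁ (FromCOC.reduction-run I)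
  ; computes     = λ I → proj₂ (proj₂ (FromCOC.reduction-run I))
  -- The factor must be at least 1 even at parameter 0; the successor satisfies this, and it also
  -- dominates the identity as `g` requires.
  ; f            = suc
  ; f-computable = Successor.computable
  ; exponent     = 6
  ; time-bound   = λ I κ _ → ≤-trans (proj₁ (proj₂ (FromCOC.reduction-run I)))
      (m≤m+n (length (ParameterizedProblem.encode SemiWeightedCOC I) ^ 6) _)
  ; g            = suc
  ; g-computable = Successor.computable
  ; param-bound  = λ I κ κ′ κ-fes+Δ κ′-fes+Δ →
      m≤n⇒m≤1+n (fes+Δ-withIsolated (graph (COCInstance.input I)) (FromCOC.k I) κ κ′
        κ-fes+Δ κ′-fes+Δ)
  }
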